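{- Let $K\ge 2$ be a power of two. $K$-way LCP-mergesort, as described in the context, sorts any set $\mathcal S$ of $n$ strings and computes its LCP array $H$ using fewer than $L(H) + n\lceil\log_K n\rceil\log_2 K + n + \lceil\frac{n-1}{K-1}\rceil$ character comparisons, and runs in $O(D+n\log n)$ time.
   Context: Strings are zero-terminated finite sequences over a totally ordered alphabet, ordered lexicographically; $\mathrm{lcp}(s,t)$ is the length of their longest common prefix. For a sorted sequence $s_1\le\dots\le s_n$ its LCP array is $H=(\bot,h_2,\dots,h_n)$, $h_i=\mathrm{lcp}(s_{i-1},s_i)$, and $L(H)=\sum_{i\ge 2}h_i$. The distinguishing prefix size $D$ is the sum over all $s\in\mathcal S$ of the length of the shortest prefix of $s$ that is not a prefix of any other string of $\mathcal S$ ($D\ge L(H)$). $K$-way LCP-merge is the procedure merging $K$ sorted sequences with LCP arrays via an LCP-aware tournament tree: $K$ calls of LCP-Compare to build the tree and $\log_2 K$ calls per output string to replay the leaf-to-root path of the previous winner, where LCP-Compare on $(a,s_a,h_a),(b,s_b,h_b)$ with $h_a=\mathrm{lcp}(p,s_a)$, $h_b=\mathrm{lcp}(p,s_b)$, $p\le s_a,s_b$ decides by the LCPs when $h_a\ne h_b$ (the string with larger LCP is smaller; resulting lcp is $\min(h_a,h_b)$) and otherwise compares characters from position $h_a+1$ on until a mismatch or terminator; it returns the smaller index with its LCP, and the larger index with $\mathrm{lcp}(s_a,s_b)$. Counting convention: each character comparison yielding equality counts one; the final mismatch test counts one; the LCP-only cases count zero. $K$-way LCP-mergesort: a set of size at most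 1 is returned with trivial LCP array; otherwise the input is split into $K$ parts of nearly equal size (some possibly empty when $n<K$), each part is sorted recursively together with its LCP array, and the $K$ results are combined by one $K$-way LCP-merge (used at every level, including when $n<K$). -}

module Defs where

open import Level using (Level)
open import Data.Bool.Base using (Bool; true; false)
open import Data.List.Base using (List; []; _∷_; _++_; map; length; drop; take; zipWith; catMaybes)
open import Data.List.Properties using (≡-dec)
open import Data.List.Relation.Binary.Lex.Strict using (≤-decTotalOrder)
open import Data.List.Relation.Binary.Prefix.Heterogeneous using (Prefix)
open import Data.List.Relation.Binary.Prefix.Heterogeneous.Properties using (prefix?)
open import Data.List.Relation.Unary.All using (All; all?)
import Data.List.Relation.Unary.Sorted.TotalOrder as SortedList
open import Data.Maybe.Base using (Maybe; just; nothing; fromMaybe)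
import Data.Maybe.Properties as Maybe
open import Data.Nat.Base using (ℕ; zero; suc; _+_; _∸_; _^_; z≤n; s≤s; NonZero; >-nonZero)
open import Data.Nat.DivMod using (_/_)
open import Data.Nat.ListAction using (sum)
open import Data.Nat.Properties using (_≤?_; <-cmp; ^-monoʳ-≤; ∸-monoˡ-≤)
open import Data.Product.Base using (_×_; _,_)
open import Data.Unit.Base using (⊤; tt)
open import Data.Vec.Base using (Vec; []; _∷_)
open import Relation.Binary.Bundles using (StrictTotalOrder; DecTotalOrder)
open import Relation.Binary.Core using (Rel)
open import Relation.Binary.Definitions using (DecidableEquality; tri<; tri≈; tri>)
open import Relation.Binary.PropositionalEquality using (_≡_; _≢_)
open import Relation.Binary.Structures using (IsStrictTotalOrder)
open import Relation.Nullary using (¬_; yes; no)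
open import Relation.Nullary.Decidable using (¬?; _→-dec_)
open import Relation.Unary using (Pred; Decidable)

private
  variable
    a p : Level
    d : ℕ

------------------------------------------------------------------------
-- Arithmetic

-- The least i < b satisfying P, or b if there is none.
least : {P : Pred ℕ p} → Decidable P → (b : ℕ) → ℕ
least P? zero = 0
least P? (suc b) with P? 0
... | yes _ = 0
... | no  _ = suc (least (λ i → P? (suc i)) b)

-- The least j with n ≤ b ^ j; the cut-off n is harmless as n ≤ b ^ n for b ≥ 2.
⌈log[_]_⌉ : ℕ → ℕ → ℕ
⌈log[ b ] n ⌉ = least (λ j → n ≤? b ^ j) n

⌈_/_⌉ : (m n : ℕ) .{{_ : NonZero n}} → ℕ
⌈ m / n ⌉ = (m + (n ∸ 1)) / n

2^k∸1-nonZero : ∀ k .{{_ : NonZero k}} → NonZero (2 ^ k ∸ 1)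
2^k∸1-nonZero (suc k) =
  >-nonZero (∸-monoˡ-≤ 1 (^-monoʳ-≤ 2 {1} {suc k} (s≤s z≤n)))

------------------------------------------------------------------------
-- Cost-counting computations

-- A result together with the number of character comparisons and the number
-- of unit-cost steps spent on it.
--
-- The model is a unit-cost RAM.  Every call of a function of the algorithm
-- spends at least one step; the pure operations in its body take constant time on a
-- RAM: a string is an array (so going to position h by drop is indexing), the
-- length of a sequence is stored with it, and numbers and pointers fit
-- in one word.
record Cost (A : Set a) : Set a where
  constructor cost
  field
    result      : A
    comparisons : ℕ
    time        : ℕ

open Cost public

return : {A : Set a} → A → Cost A
return x = cost x 0 0

infixl 1 _>>=_ _>>_

_>>=_ : ∀ {b} {A : Set a} {B : Set b} → Cost A → (A → Cost B) → Cost B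
m >>= f = cost (result r) (comparisons m + comparisons r) (time m + time r)
  where r = f (result m)

_>>_ : ∀ {b} {A : Set a} {B : Set b} → Cost A → Cost B → Cost B
x >> y = x >>= λ _ → y

step : Cost ⊤
step = cost tt 0 1

compareCharacters : Cost ⊤
compareCharacters = cost tt 1 1

------------------------------------------------------------------------
-- Perfect binary trees with 2 ^ d leaves

data Tree (X : Set a) : ℕ → Set a where
  leaf : X → Tree X 0
  node : Tree X d → Tree X d → Tree X (suc d)

mapTree : ∀ {b} {X : Set a} {Y : Set b} → (X → Cost Y) → Tree X d → Cost (Tree Y d)
mapTree f (leaf x) = do
  step
  y ← f x
  return (leaf y)
mapTree f (node l r) = do
  step
  l′ ← mapTree f l
  r′ ← mapTree f r
  return (node l′ r′)

------------------------------------------------------------------------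

module LCPMergesort {a ℓ} {A : Set a} {_≺_ : Rel A ℓ} (isSTO : IsStrictTotalOrder _≡_ _≺_) where

  private
    module A = IsStrictTotalOrder isSTO

  alphabet : StrictTotalOrder a a ℓ
  alphabet = record { isStrictTotalOrder = isSTO }

  -- The zero terminator of a string is implicit.  The lexicographic order
  -- puts [] first, in accordance with the terminator being smaller than every
  -- character.
  Str : Set a
  Str = List A

  _≟_ : DecidableEquality Str
  _≟_ = ≡-dec A._≟_

  Sorted : Pred (List Str) _
  Sorted = SortedList.Sorted (DecTotalOrder.totalOrder (≤-decTotalOrder alphabet))

  ----------------------------------------------------------------------
  -- LCP arrays and distinguishing prefixes

  lcp : Str → Str → ℕ
  lcp []      _       = 0
  lcp (_ ∷ _) []      = 0
  lcp (x ∷ s) (y ∷ t) with x A.≟ y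
  ... | yes _ = suc (lcp s t)
  ... | no  _ = 0

  -- The entry ⊥ is nothing.
  LCPArray : Set
  LCPArray = List (Maybe ℕ)

  lcpArray : List Str → LCPArray
  lcpArray []       = []
  lcpArray (s ∷ ss) = nothing ∷ zipWith (λ t u → just (lcp t u)) (s ∷ ss) ss

  L : LCPArray → ℕ
  L H = sum (catMaybes H)

  terminated : Str → List (Maybe A)
  terminated s = map just s ++ nothing ∷ []

  Distinguishing : List Str → Str → Pred ℕ _
  Distinguishing S s i =
    All (λ t → t ≢ s → ¬ Prefix _≡_ (take i (terminated s)) (terminated t)) S

  distinguishing? : ∀ S s → Decidable (Distinguishing S s)
  distinguishing? S s i = all? (λ t → ¬? (t ≟ s) →-dec
    ¬? (prefix? (Maybe.≡-dec A._≟_) (take i (terminated s)) (terminated t))) S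

  -- The whole of terminated s is always distinguishing.
  distinguishingPrefixLength : List Str → Str → ℕ
  distinguishingPrefixLength S s =
    least (distinguishing? S s) (length (terminated s))

  D : List Str → ℕ
  D S = sum (map (distinguishingPrefixLength S) S)

  ----------------------------------------------------------------------
  -- LCP-Compare

  -- Whether s ≤ t, and h + lcp s t.  The end of a string acts as the
  -- terminator.
  compareFrom : ℕ → Str → Str → Cost (Bool × ℕ)
  compareFrom h [] _ = do
    compareCharacters
    return (true , h)
  compareFrom h (_ ∷ _) [] = do
    compareCharacters
    return (false , h)
  compareFrom h (x ∷ s) (y ∷ t) with A.compare x y
  ... | tri< _ _ _ = do
    compareCharacters
    return (true , h)
  ... | tri≈ _ _ _ = do
    compareCharacters
    compareFrom (suc h) s t
  ... | tri> _ _ _ = do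
    compareCharacters
    return (false , h)

  -- The current head of one of the 2 ^ d sequences being merged: the sequence
  -- is identified by the path to its leaf, and the head is a string with an
  -- LCP value, or nothing if the sequence is exhausted.
  record Contender (d : ℕ) : Set a where
    constructor contender
    field
      index : Vec Bool d
      head  : Maybe (Str × ℕ)

  open Contender public

  -- The smaller contender followed by the larger.  An exhausted sequence acts
  -- as a sentinel larger than all strings; no characters are compared with it.
  lcpCompare : Contender d → Contender d → Cost (Contender d × Contender d)
  lcpCompare x (contender j nothing) = do
    step
    return (x , contender j nothing)
  lcpCompare (contender i nothing) y@(contender _ (just _)) = do
    step
    return (y , contender i nothing)
  lcpCompare x@(contender i (just (s , h))) y@(contender j (just (t , h′)))
    with <-cmp h h′
  ... | tri< _ _ _ = do
    step
    return (y , x)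
  ... | tri> _ _ _ = do
    step
    return (x , y)
  ... | tri≈ _ _ _ = do
    step
    s≤t , h″ ← compareFrom h (drop h s) (drop h t)
    return (order s≤t h″)
    where
    order : Bool → ℕ → Contender _ × Contender _
    order true  h″ = x , contender j (just (t , h″))
    order false h″ = y , contender i (just (s , h″))

  ----------------------------------------------------------------------
  -- K-way LCP-merge, for K = 2 ^ k

  -- A sorted sequence zipped with its LCP array.
  Run : Set a
  Run = List (Str × Maybe ℕ)

  -- Every inner node stores the loser of the match played there, every leaf
  -- the part of its sequence behind the current head.
  data LoserTree : ℕ → Set a where
    leaf : Run → LoserTree 0
    node : Contender (suc d) → LoserTree d → LoserTree d → LoserTree (suc d)

  -- An LCP entry ⊥ occurs at the start of a run only, where LCPs are relative
  -- to the empty string.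
  advance : Run → Contender 0 × LoserTree 0
  advance []            = contender [] nothing , leaf []
  advance ((s , h) ∷ r) = contender [] (just (s , fromMaybe 0 h)) , leaf r

  below : Bool → Contender d → Contender (suc d)
  below b (contender i x) = contender (b ∷ i) x

  -- With 2 ^ d sequences there are 2 ^ d − 1 matches.
  build : Tree Run d → Cost (Contender d × LoserTree d)
  build (leaf r) = do
    step
    return (advance r)
  build (node l r) = do
    step
    x , l′ ← build l
    y , r′ ← build r
    winner , loser ← lcpCompare (below false x) (below true y)
    return (winner , node loser l′ r′)

  -- Advance the sequence of the previous winner and replay the matches on the
  -- path from its leaf to the root.
  replay : Vec Bool d → LoserTree d → Cost (Contender d × LoserTree d)
  replay [] (leaf r) = do
    step
    return (advance r)
  replay (false ∷ i) (node y l r) = do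
    step
    x , l′ ← replay i l
    winner , loser ← lcpCompare (below false x) y
    return (winner , node loser l′ r)
  replay (true ∷ i) (node y l r) = do
    step
    x , r′ ← replay i r
    winner , loser ← lcpCompare (below true x) y
    return (winner , node loser l r′)

  -- Output n strings.
  outputs : ℕ → Contender d → LoserTree d → Cost Run
  outputs zero _ _ = do
    step
    return []
  outputs (suc _) (contender _ nothing) _ = do
    step
    return []
  outputs (suc n) (contender i (just (s , h))) T = do
    step
    winner , T′ ← replay i T
    r ← outputs n winner T′
    return ((s , just h) ∷ r)

  undefineFirst : Run → Run
  undefineFirst []            = []
  undefineFirst ((s , _) ∷ r) = (s , nothing) ∷ r

  -- The first argument is the total length of the runs.
  kWayMerge : ∀ k → ℕ → Tree Run k → Cost Run
  kWayMerge k n runs = do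
    step
    winner , T ← build runs
    r ← outputs n winner T
    return (undefineFirst r)

  ----------------------------------------------------------------------
  -- K-way LCP-mergesort, for K = 2 ^ k

  halve : List Str → Cost (List Str × List Str)
  halve [] = do
    step
    return ([] , [])
  halve (s ∷ ss) = do
    step
    ts , us ← halve ss
    return (s ∷ us , ts)

  -- Each of the 2 ^ k parts of a list of length n has length ⌊n / 2 ^ k⌋ or
  -- ⌈n / 2 ^ k⌉.
  split : ∀ k → List Str → Cost (Tree (List Str) k)
  split zero S = do
    step
    return (leaf S)
  split (suc k) S = do
    step
    S₁ , S₂ ← halve S
    l ← split k S₁
    r ← split k S₂
    return (node l r)

  -- The second argument bounds the recursion depth.
  sortWithin : ℕ → ℕ → List Str → Cost Run
  sortWithin k _ [] = do
    step
    return []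
  sortWithin k _ (s ∷ []) = do
    step
    return ((s , nothing) ∷ [])
  sortWithin k zero (_ ∷ _ ∷ _) = do
    step
    return []
  sortWithin k (suc depth) S@(_ ∷ _ ∷ _) = do
    step
    parts ← split k S
    runs ← mapTree (sortWithin k depth) parts
    kWayMerge k (length S) runs

  -- The depth bound length S is never exhausted for k ≥ 1: the parts of a list
  -- of length at least 2 are shorter than the list.
  mergesort : ∀ k → List Str → Cost Run
  mergesort k S = sortWithin k (length S) S

-- Every equality found by LCP-Compare raises one LCP value by one, so the
-- equalities of all merges together telescope to L(H).  A mismatch needs two
-- non-exhausted contenders: building the tree of a merge therefore causes at most
-- (number of nonempty runs) − 1 mismatches, which sums to at most n − 1 over the recursion,
-- and replaying causes at most log₂ K of them per output string and level.

module Submission where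

open import Defs
open import Algebra.Bundles using (CommutativeMonoid)
open import Data.Bool.Base using (Bool; true; false; not)
open import Data.List.Base using (List; []; _∷_; _++_; [_]; map; length; drop; take; concat; zipWith)
open import Data.List.Properties using (length-map; length-++; map-++; concat-++; ++-identityʳ; ++-assoc)
open import Data.List.Relation.Binary.Lex.Strict using (Lex-≤; base; halt; this; next)
open import Data.List.Relation.Binary.Permutation.Propositional
  using (_↭_; ↭-refl; ↭-sym; ↭-trans; ↭-reflexive; ↭⇒↭ₛ; prep; module PermutationReasoning)
open import Data.List.Relation.Binary.Permutation.Propositional.Properties as ↭
  using (↭-length; map⁺; catMaybes-↭; ++-comm; ++⁺ˡ; shifts)
open import Data.List.Membership.Propositional using (_∈_)
open import Data.List.Relation.Binary.Prefix.Heterogeneous using (Prefix; []; _∷_)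
open import Data.List.Relation.Unary.AllPairs using ([]; _∷_)
open import Data.List.Relation.Unary.Linked using ([]; [-]; _∷_)
import Data.List.Relation.Binary.Permutation.Setoid.Properties as ↭ₛ
open import Data.List.Relation.Unary.All as All using (All; []; _∷_)
import Data.List.Relation.Unary.All.Properties as All
open import Data.List.Relation.Unary.Unique.Propositional using (Unique)
open import Data.Maybe.Base as Maybe using (Maybe; just; nothing; fromMaybe)
open import Data.Nat.Base using (ℕ; zero; suc; NonZero; _+_; _*_; _∸_; _^_; _≤_; _<_; _⊔_; z≤n; s≤s; s≤s⁻¹; s<s⁻¹; ⌊_/2⌋; ⌈_/2⌉)
open import Data.Nat.ListAction using (sum)
open import Data.Nat.ListAction.Properties using (sum-++; sum-↭)
open import Data.Nat.Logarithm using (⌈log₂_⌉; ⌈log₂⌉-mono-≤; ⌈log₂⌈n/2⌉⌉≡⌈log₂n⌉∸1; ⌈log₂2^n⌉≡n)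
open import Data.Nat.Properties
open import Data.Nat.Tactic.RingSolver using (solve-∀)
open import Data.Product.Base using (_×_; _,_; ∃-syntax; proj₁; proj₂)
open import Data.Unit.Base using (tt)
open import Data.Vec.Base using (Vec; []; _∷_)
import Level
open import Relation.Binary.Core using (Rel)
open import Relation.Binary.Definitions using (tri<; tri≈; tri>)
open import Relation.Binary.PropositionalEquality
  using (_≡_; _≢_; refl; sym; trans; cong; cong₂; subst; subst₂; setoid; module ≡-Reasoning)
open import Relation.Binary.Structures using (IsStrictTotalOrder)
open import Relation.Nullary using (Dec; yes; no; contradiction)

-- All counts are inequalities between sums, so truncated subtraction never occurs: the 1 in "number
-- of runs minus 1" appears as `occupied` on the smaller side. In a call on a nonempty set, the
-- nonempty parts P contribute |P| - 1 mismatches each and the root merge contributes the number of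
-- these parts minus 1, together the size of the set minus 1. The missing 1 makes the final
-- inequality strict. The obstacle is that an LCP value means something only relative to another
-- string, and different nodes of the loser tree refer to different strings. The invariant is that a
-- loser's value refers to the string that beat it. Once that string is output, all values on its
-- path refer to the last output, so a replay only compares values with a common reference. The
-- recursion is controlled by `n ≤ K ^ d` with `d` the rounded logarithm to base `K`. Time is
-- comparisons plus steps, and L(H) is bounded by the distinguishing prefixes.

private
  variable
    d : ℕ

-- Least indices and logarithms

least-elim : ∀ {p q} {P : ℕ → Set p} (P? : ∀ i → Dec (P i)) b (Q : ℕ → Set q) →
             (∀ {i} → P i → Q i) → Q b → Q (least P? b)
least-elim P? zero    Q P⇒Q Qb = Qb
least-elim P? (suc b) Q P⇒Q Qb with P? 0
... | yes P0 = P⇒Q P0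
... | no  _  = least-elim (λ i → P? (suc i)) b (λ i → Q (suc i)) P⇒Q Qb

least≤bound : ∀ {p} {P : ℕ → Set p} (P? : ∀ i → Dec (P i)) b → least P? b ≤ b
least≤bound P? zero = z≤n
least≤bound P? (suc b) with P? 0
... | yes _ = z≤n
... | no  _ = s≤s (least≤bound (λ i → P? (suc i)) b)

least-minimal : ∀ {p} {P : ℕ → Set p} (P? : ∀ i → Dec (P i)) b {i} → P i → least P? b ≤ i
least-minimal P? zero    Pi = z≤n
least-minimal P? (suc b) {i} Pi with P? 0
... | yes _ = z≤n
least-minimal P? (suc b) {zero}  Pi | no ¬P0 = contradiction Pi ¬P0
least-minimal P? (suc b) {suc i} Pi | no _   = s≤s (least-minimal (λ i → P? (suc i)) b Pi)

n≤2*⌈n/2⌉ : ∀ n → n ≤ 2 * ⌈ n /2⌉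
n≤2*⌈n/2⌉ n = begin
  n                       ≡⟨ ⌊n/2⌋+⌈n/2⌉≡n n ⟨
  ⌊ n /2⌋ + ⌈ n /2⌉       ≤⟨ +-monoˡ-≤ ⌈ n /2⌉ (⌊n/2⌋≤⌈n/2⌉ n) ⟩
  ⌈ n /2⌉ + ⌈ n /2⌉       ≡⟨ cong (⌈ n /2⌉ +_) (+-identityʳ ⌈ n /2⌉) ⟨
  2 * ⌈ n /2⌉             ∎
  where open ≤-Reasoning

1≤⌈log₂2+n⌉ : ∀ n → 1 ≤ ⌈log₂ (2 + n) ⌉
1≤⌈log₂2+n⌉ n = ≤-trans (≤-reflexive (sym (⌈log₂2^n⌉≡n 1))) (⌈log₂⌉-mono-≤ {2} {2 + n} (s≤s (s≤s z≤n)))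

-- Induction on `j`: passing from `n` to `⌈ n /2⌉` lowers the logarithm by one and at most halves
-- the number.
⌈log₂n⌉≤j⇒n≤2^j : ∀ j n → ⌈log₂ n ⌉ ≤ j → n ≤ 2 ^ j
⌈log₂n⌉≤j⇒n≤2^j zero    zero          _  = z≤n
⌈log₂n⌉≤j⇒n≤2^j zero    (suc zero)    _  = ≤-refl
⌈log₂n⌉≤j⇒n≤2^j zero    (suc (suc n)) ≤0 = contradiction (≤-trans (1≤⌈log₂2+n⌉ n) ≤0) λ ()
⌈log₂n⌉≤j⇒n≤2^j (suc j) n             ≤j = ≤-trans (n≤2*⌈n/2⌉ n)
  (*-monoʳ-≤ 2 (⌈log₂n⌉≤j⇒n≤2^j j ⌈ n /2⌉
    (≤-trans (≤-reflexive (⌈log₂⌈n/2⌉⌉≡⌈log₂n⌉∸1 n)) (∸-monoˡ-≤ 1 ≤j))))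

-- The summand 1 is for `n = 1`, where the logarithm vanishes. This absorbs the linear terms of the
-- running time.
n≤n*⌈log₂n⌉+1 : ∀ n → n ≤ n * ⌈log₂ n ⌉ + 1
n≤n*⌈log₂n⌉+1 zero            = z≤n
n≤n*⌈log₂n⌉+1 (suc zero)      = ≤-refl
n≤n*⌈log₂n⌉+1 n@(suc (suc m)) = ≤-trans
  (≤-trans (≤-reflexive (sym (*-identityʳ n))) (*-monoʳ-≤ n (1≤⌈log₂2+n⌉ m)))
  (m≤m+n _ 1)

2≤2^k : ∀ k .{{_ : NonZero k}} → 2 ≤ 2 ^ k
2≤2^k (suc k) = ^-monoʳ-≤ 2 {1} {suc k} (s≤s z≤n)

n≤2^n : ∀ n → n ≤ 2 ^ n
n≤2^n zero    = z≤n
n≤2^n (suc n) = +-mono-≤ (m^n>0 2 n) (≤-trans (n≤2^n n) (≤-reflexive (sym (+-identityʳ (2 ^ n)))))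

module _ {b} (2≤b : 2 ≤ b) where

  n≤b^⌈log[b]n⌉ : ∀ n → n ≤ b ^ ⌈log[ b ] n ⌉
  n≤b^⌈log[b]n⌉ n = least-elim (λ j → n ≤? b ^ j) n (λ j → n ≤ b ^ j) (λ n≤ → n≤)
    (≤-trans (n≤2^n n) (^-monoˡ-≤ n 2≤b))

  -- The binary logarithm is a candidate exponent for base `b` too, because `2 ^ j ≤ b ^ j`.
  ⌈log[b]n⌉≤⌈log₂n⌉ : ∀ n → ⌈log[ b ] n ⌉ ≤ ⌈log₂ n ⌉
  ⌈log[b]n⌉≤⌈log₂n⌉ n = least-minimal (λ j → n ≤? b ^ j) n
    (≤-trans (⌈log₂n⌉≤j⇒n≤2^j ⌈log₂ n ⌉ n ≤-refl) (^-monoˡ-≤ ⌈log₂ n ⌉ 2≤b))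

-- Time bounds and perfect trees

-- A record and not a synonym for the inequality, so that unification recovers `c` and `b`, which
-- cannot be read off a sum.
record Bounded (t c b : ℕ) : Set where
  constructor bounded-by
  field
    time≤ : t ≤ c + b

open Bounded

bounded-+ : ∀ {t c b t′ c′ b′} → Bounded t c b → Bounded t′ c′ b′ →
            Bounded (t + t′) (c + c′) (b + b′)
bounded-+ {t} {c} {b} {t′} {c′} {b′} (bounded-by p) (bounded-by q) =
  bounded-by (≤-trans (+-mono-≤ p q) (≤-reflexive (eq c b c′ b′)))
  where
  eq : ∀ c b c′ b′ → c + b + (c′ + b′) ≡ c + c′ + (b + b′)
  eq = solve-∀

bounded-weaken : ∀ {t c b b′} → b ≤ b′ → Bounded t c b → Bounded t c b′
bounded-weaken {c = c} b≤b′ (bounded-by p) = bounded-by (≤-trans p (+-monoʳ-≤ c b≤b′))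

bounded-step : Bounded 1 0 1
bounded-step = bounded-by ≤-refl

bounded-return : Bounded 0 0 0
bounded-return = bounded-by ≤-refl

leaves : ∀ {x} {X : Set x} → Tree X d → List X
leaves (leaf x)   = [ x ]
leaves (node l r) = leaves l ++ leaves r

occupied : ∀ {x} {X : Set x} → List X → ℕ
occupied []      = 0
occupied (_ ∷ _) = 1

sum-map-++ : ∀ {z} {Z : Set z} (g : Z → ℕ) xs ys →
             sum (map g (xs ++ ys)) ≡ sum (map g xs) + sum (map g ys)
sum-map-++ g xs ys = trans (cong sum (map-++ g xs ys)) (sum-++ (map g xs) (map g ys))

module _ {x y} {X : Set x} {Y : Set y} (f : X → Cost Y) where

  mapTree-leaves : ∀ (t : Tree X d) → leaves (result (mapTree f t)) ≡ map (λ x → result (f x)) (leaves t)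
  mapTree-leaves (leaf x)   = refl
  mapTree-leaves (node l r) = trans
    (cong₂ _++_ (mapTree-leaves l) (mapTree-leaves r))
    (sym (map-++ _ (leaves l) (leaves r)))

  mapTree-comparisons : ∀ (t : Tree X d) →
    comparisons (mapTree f t) ≡ sum (map (λ x → comparisons (f x)) (leaves t))
  mapTree-comparisons (leaf x)   = refl
  mapTree-comparisons (node l r) = begin
    cl + (cr + 0)                                   ≡⟨ cong (cl +_) (+-identityʳ cr) ⟩
    cl + cr                                         ≡⟨ cong₂ _+_ (mapTree-comparisons l) (mapTree-comparisons r) ⟩
    sum (map c (leaves l)) + sum (map c (leaves r)) ≡⟨ sum-map-++ c (leaves l) (leaves r) ⟨
    sum (map c (leaves l ++ leaves r))              ∎
    where
    open ≡-Reasoning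
    c : X → ℕ
    c x = comparisons (f x)
    cl = comparisons (mapTree f l)
    cr = comparisons (mapTree f r)

  -- One step per node, and a perfect tree with `2 ^ d` leaves has one node less than `2 * 2 ^ d`.
  mapTree-time : ∀ (t : Tree X d) →
    suc (time (mapTree f t)) ≡ 2 * 2 ^ d + sum (map (λ x → time (f x)) (leaves t))
  mapTree-time (leaf x)           = refl
  mapTree-time {suc d} (node l r) = begin
    2 + (tl + (tr + 0))                                      ≡⟨ eq₁ tl tr ⟩
    suc tl + suc tr                                          ≡⟨ cong₂ _+_ (mapTree-time l) (mapTree-time r) ⟩
    2 * 2 ^ d + sum (map t (leaves l)) + (2 * 2 ^ d + sum (map t (leaves r))) ≡⟨ eq₂ (2 ^ d) _ _ ⟩
    2 * 2 ^ suc d + (sum (map t (leaves l)) + sum (map t (leaves r))) ≡⟨ cong (2 * 2 ^ suc d +_) (sum-map-++ t (leaves l) (leaves r)) ⟨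
    2 * 2 ^ suc d + sum (map t (leaves l ++ leaves r))       ∎
    where
    open ≡-Reasoning
    t : X → ℕ
    t x = time (f x)
    tl = time (mapTree f l)
    tr = time (mapTree f r)
    eq₁ : ∀ a b → 2 + (a + (b + 0)) ≡ suc a + suc b
    eq₁ = solve-∀
    eq₂ : ∀ m a b → 2 * m + a + (2 * m + b) ≡ 2 * (2 * m) + (a + b)
    eq₂ = solve-∀

occupied-↭ : ∀ {x} {X : Set x} {xs ys : List X} → xs ↭ ys → occupied xs ≡ occupied ys
occupied-↭ {xs = []}    {[]}    _ = refl
occupied-↭ {xs = _ ∷ _} {_ ∷ _} _ = refl
occupied-↭ {xs = []}    {_ ∷ _} p = contradiction (↭-sym p) ↭.¬x∷xs↭[]
occupied-↭ {xs = _ ∷ _} {[]}    p = contradiction p ↭.¬x∷xs↭[]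

occupied-map : ∀ {x y} {X : Set x} {Y : Set y} (f : X → Y) xs → occupied (map f xs) ≡ occupied xs
occupied-map f []      = refl
occupied-map f (_ ∷ _) = refl

occupied≡1 : ∀ {x} {X : Set x} (xs : List X) → 1 ≤ length xs → occupied xs ≡ 1
occupied≡1 (_ ∷ _) _ = refl

leaves-length : ∀ {x} {X : Set x} (t : Tree X d) → length (leaves t) ≡ 2 ^ d
leaves-length (leaf x)           = refl
leaves-length {suc d} (node l r) = begin
  length (leaves l ++ leaves r)          ≡⟨ length-++ (leaves l) ⟩
  length (leaves l) + length (leaves r)  ≡⟨ cong₂ _+_ (leaves-length l) (leaves-length r) ⟩
  2 ^ d + 2 ^ d                          ≡⟨ cong (2 ^ d +_) (+-identityʳ (2 ^ d)) ⟨
  2 ^ suc d                              ∎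
  where open ≡-Reasoning

-- The summands are nested like the binds of `build`, so that the bound in `build-time` holds by
-- computation.
buildSteps : ℕ → ℕ
buildSteps zero    = 1
buildSteps (suc d) = 1 + (buildSteps d + (buildSteps d + 1))

splitSteps : ℕ → ℕ
splitSteps zero    = 1
splitSteps (suc k) = 2 + (splitSteps k + splitSteps k)

-- Per string and level: `k` steps of splitting and `2 + 2 * k` of output. The bracket collects the
-- costs per call; its `3 * 2 ^ k` is two for traversing the tree of parts and one for the constant
-- step of each part.
sortFactor : ℕ → ℕ
sortFactor k = 2 + 3 * k + (splitSteps k + 3 * 2 ^ k + buildSteps k + 2)

module Properties {a ℓ} {A : Set a} {_≺_ : Rel A ℓ} (isSTO : IsStrictTotalOrder _≡_ _≺_) where

  open LCPMergesort isSTO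
  private
    module A = IsStrictTotalOrder isSTO

  -- Lexicographic order and longest common prefixes

  infix 4 _⊑_

  _⊑_ : Rel Str _
  _⊑_ = Lex-≤ _≡_ _≺_

  private
    variable
      s t : Str

  []⊑_ : ∀ s → [] ⊑ s
  []⊑ []      = base tt
  []⊑ (_ ∷ _) = halt

  lcp-≡ : ∀ x → lcp (x ∷ s) (x ∷ t) ≡ suc (lcp s t)
  lcp-≡ x with x A.≟ x
  ... | yes _   = refl
  ... | no  x≢x = contradiction refl x≢x

  lcp-≢ : ∀ {x y} → x ≢ y → lcp (x ∷ s) (y ∷ t) ≡ 0
  lcp-≢ {x = x} {y} x≢y with x A.≟ y
  ... | yes x≡y = contradiction x≡y x≢y
  ... | no  _   = refl

  lcp-comm : ∀ s t → lcp s t ≡ lcp t s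
  lcp-comm []      []      = refl
  lcp-comm []      (_ ∷ _) = refl
  lcp-comm (_ ∷ _) []      = refl
  lcp-comm (x ∷ s) (y ∷ t) with x A.≟ y
  ... | yes refl = trans (cong suc (lcp-comm s t)) (sym (lcp-≡ x))
  ... | no  x≢y  = sym (lcp-≢ (λ y≡x → x≢y (sym y≡x)))

  ≺⇒lcp≡0 : ∀ {x y} → x ≺ y → lcp (x ∷ s) (y ∷ t) ≡ 0
  ≺⇒lcp≡0 x≺y = lcp-≢ λ x≡y → A.irrefl x≡y x≺y

  -- Where `s` first departs from `p`, it does so upwards, and `t` still agrees with `p` there. So
  -- `s` departs from `t` at the same place and upwards: the case decided without reading
  -- characters.
  larger-lcp⇒smaller : ∀ {p s t} → p ⊑ s → p ⊑ t → lcp p s < lcp p t →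
                       t ⊑ s × lcp p s ≡ lcp t s
  larger-lcp⇒smaller (base _)      _          ()
  larger-lcp⇒smaller halt          _          ()
  larger-lcp⇒smaller {p = p} {s} _ (this x≺z) lt =
    contradiction (subst (lcp p s <_) (≺⇒lcp≡0 x≺z) lt) n≮0
  larger-lcp⇒smaller (this x≺y)    (next refl _) _ =
    this x≺y , trans (≺⇒lcp≡0 x≺y) (sym (≺⇒lcp≡0 x≺y))
  larger-lcp⇒smaller {x ∷ _} (next refl p⊑s) (next refl p⊑t) lt
    with t⊑s , eq ← larger-lcp⇒smaller p⊑s p⊑t (s<s⁻¹ (subst₂ _<_ (lcp-≡ x) (lcp-≡ x) lt))
    = next refl t⊑s , trans (lcp-≡ x) (trans (cong suc eq) (sym (lcp-≡ x)))

  -- The first `h` characters of both strings are those of `p`, hence equal; this is why a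
  -- comparison may start at position `h`.
  drop-common : ∀ h p s t → h ≤ lcp p s → h ≤ lcp p t →
                lcp s t ≡ h + lcp (drop h s) (drop h t) × (drop h s ⊑ drop h t → s ⊑ t)
  drop-common zero    _       _       _       _   _   = refl , λ s⊑t → s⊑t
  drop-common (suc h) (x ∷ p) (y ∷ s) (z ∷ t) h≤s h≤t with x A.≟ y | x A.≟ z
  ... | yes refl | yes refl with eq , ⊑⁺ ← drop-common h p s t (s≤s⁻¹ h≤s) (s≤s⁻¹ h≤t)
    = trans (lcp-≡ x) (cong suc eq) , λ s⊑t → next refl (⊑⁺ s⊑t)

  -- Indexed by the returned pair, so that matching on the evidence also reveals the Boolean on
  -- which `lcpCompare` branches.
  data Comparison (h : ℕ) (s t : Str) : Bool × ℕ → Set (a Level.⊔ ℓ) where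
    ≤-result : s ⊑ t → ∀ {h″} → h″ ≡ h + lcp s t → Comparison h s t (true , h″)
    ≥-result : t ⊑ s → ∀ {h″} → h″ ≡ h + lcp s t → Comparison h s t (false , h″)

  compareFrom-comparison : ∀ h s t → Comparison h s t (result (compareFrom h s t))
  compareFrom-comparison h []      t       = ≤-result ([]⊑ t) (sym (+-identityʳ h))
  compareFrom-comparison h (x ∷ s) []      = ≥-result halt (sym (+-identityʳ h))
  compareFrom-comparison h (x ∷ s) (y ∷ t) with A.compare x y
  ... | tri< x≺y x≢y _ =
    ≤-result (this x≺y) (sym (trans (cong (h +_) (lcp-≢ x≢y)) (+-identityʳ h)))
  ... | tri> _ x≢y y≺x =
    ≥-result (this y≺x) (sym (trans (cong (h +_) (lcp-≢ x≢y)) (+-identityʳ h)))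
  ... | tri≈ _ refl _
    with result (compareFrom (suc h) s t) | compareFrom-comparison (suc h) s t
  ... | _ | ≤-result s⊑t eq = ≤-result (next refl s⊑t) (trans eq suc+)
    where suc+ = trans (sym (+-suc h _)) (cong (h +_) (sym (lcp-≡ x)))
  ... | _ | ≥-result t⊑s eq = ≥-result (next refl t⊑s) (trans eq suc+)
    where suc+ = trans (sym (+-suc h _)) (cong (h +_) (sym (lcp-≡ x)))

  -- Every comparison but the last raises the LCP value by one; the last, meeting a mismatch or a
  -- terminator, is the `suc`.
  compareFrom-comparisons : ∀ h s t → comparisons (compareFrom h s t) + h ≡
                                      suc (proj₂ (result (compareFrom h s t)))
  compareFrom-comparisons h []      t       = refl
  compareFrom-comparisons h (x ∷ s) []      = refl
  compareFrom-comparisons h (x ∷ s) (y ∷ t) with A.compare x y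
  ... | tri< _ _ _ = refl
  ... | tri> _ _ _ = refl
  ... | tri≈ _ _ _ = trans (sym (+-suc _ h)) (compareFrom-comparisons (suc h) s t)

  compareFrom-time : ∀ h s t → time (compareFrom h s t) ≡ comparisons (compareFrom h s t)
  compareFrom-time h []      t       = refl
  compareFrom-time h (x ∷ s) []      = refl
  compareFrom-time h (x ∷ s) (y ∷ t) with A.compare x y
  ... | tri< _ _ _ = refl
  ... | tri> _ _ _ = refl
  ... | tri≈ _ _ _ = cong suc (compareFrom-time (suc h) s t)

  -- Runs

  strings : Run → List Str
  strings = map proj₁

  weight : Run → ℕ
  weight r = L (map proj₂ r)

  weight-∷ : ∀ s h r → weight ((s , h) ∷ r) ≡ fromMaybe 0 h + weight r
  weight-∷ s (just h) r = refl
  weight-∷ s nothing  r = refl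

  weight-++ : ∀ r r′ → weight (r ++ r′) ≡ weight r + weight r′
  weight-++ []            r′ = refl
  weight-++ ((s , h) ∷ r) r′ = begin
    weight ((s , h) ∷ r ++ r′)                ≡⟨ weight-∷ s h (r ++ r′) ⟩
    fromMaybe 0 h + weight (r ++ r′)          ≡⟨ cong (fromMaybe 0 h +_) (weight-++ r r′) ⟩
    fromMaybe 0 h + (weight r + weight r′)    ≡⟨ +-assoc (fromMaybe 0 h) _ _ ⟨
    fromMaybe 0 h + weight r + weight r′      ≡⟨ cong (_+ weight r′) (weight-∷ s h r) ⟨
    weight ((s , h) ∷ r) + weight r′          ∎
    where open ≡-Reasoning

  weight-↭ : ∀ {r r′} → r ↭ r′ → weight r ≡ weight r′
  weight-↭ r↭r′ = sum-↭ (catMaybes-↭ (map⁺ proj₂ r↭r′))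

  -- A rearrangement with new LCP values, spending c character comparisons: each
  -- of them raises an LCP value by one, except for at most m mismatches.
  infix 4 _⟶[_,_]_

  record _⟶[_,_]_ (r : Run) (c m : ℕ) (r′ : Run) : Set a where
    constructor _,_
    field
      permutes : strings r ↭ strings r′
      pays     : c + weight r ≤ m + weight r′

  open _⟶[_,_]_

  private
    variable
      r r′ r″ q q′ : Run
      c c′ m m′ : ℕ

  ⟶-length : r ⟶[ c , m ] r′ → length r ≡ length r′
  ⟶-length {r} {r′ = r′} p = begin
    length r            ≡⟨ length-map proj₁ r ⟨
    length (strings r)  ≡⟨ ↭-length (permutes p) ⟩
    length (strings r′) ≡⟨ length-map proj₁ r′ ⟩
    length r′           ∎
    where open ≡-Reasoning

  ↭⇒⟶ : r ↭ r′ → r ⟶[ 0 , 0 ] r′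
  ↭⇒⟶ r↭r′ = map⁺ proj₁ r↭r′ , ≤-reflexive (weight-↭ r↭r′)

  ≡-⟶ : q ≡ r → r ⟶[ c , m ] r′ → q ⟶[ c , m ] r′
  ≡-⟶ refl p = p

  ⟶-refl : r ⟶[ 0 , 0 ] r
  ⟶-refl = ↭⇒⟶ ↭-refl

  ⟶-trans : r ⟶[ c , m ] r′ → r′ ⟶[ c′ , m′ ] r″ → r ⟶[ c + c′ , m + m′ ] r″
  ⟶-trans {r} {c} {m} {r′} {c′} {m′} {r″} (p , e) (p′ , e′) = ↭-trans p p′ , (begin
    c + c′ + weight r      ≡⟨ eq₁ c c′ (weight r) ⟩
    c′ + (c + weight r)    ≤⟨ +-monoʳ-≤ c′ e ⟩
    c′ + (m + weight r′)   ≡⟨ eq₂ c′ m (weight r′) ⟩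
    m + (c′ + weight r′)   ≤⟨ +-monoʳ-≤ m e′ ⟩
    m + (m′ + weight r″)   ≡⟨ +-assoc m m′ _ ⟨
    m + m′ + weight r″     ∎)
    where
    open ≤-Reasoning
    eq₁ : ∀ c c′ w → c + c′ + w ≡ c′ + (c + w)
    eq₁ = solve-∀
    eq₂ : ∀ c m w → c + (m + w) ≡ m + (c + w)
    eq₂ = solve-∀

  ⟶-++ : r ⟶[ c , m ] r′ → q ⟶[ c′ , m′ ] q′ → r ++ q ⟶[ c + c′ , m + m′ ] r′ ++ q′
  ⟶-++ {r} {c} {m} {r′} {q} {c′} {m′} {q′} (p , e) (p′ , e′) =
    subst₂ _↭_ (sym (map-++ proj₁ r q)) (sym (map-++ proj₁ r′ q′)) (↭.++⁺ p p′) , (begin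
    c + c′ + weight (r ++ q)                ≡⟨ cong (c + c′ +_) (weight-++ r q) ⟩
    c + c′ + (weight r + weight q)          ≡⟨ interchange c c′ (weight r) (weight q) ⟩
    c + weight r + (c′ + weight q)          ≤⟨ +-mono-≤ e e′ ⟩
    m + weight r′ + (m′ + weight q′)        ≡⟨ interchange m m′ (weight r′) (weight q′) ⟨
    m + m′ + (weight r′ + weight q′)        ≡⟨ cong (m + m′ +_) (weight-++ r′ q′) ⟨
    m + m′ + weight (r′ ++ q′)              ∎)
    where
    open ≤-Reasoning
    interchange : ∀ a b c d → a + b + (c + d) ≡ a + c + (b + d)
    interchange = solve-∀

  ⟶-weaken : c ≡ c′ → m ≤ m′ → r ⟶[ c , m ] r′ → r ⟶[ c′ , m′ ] r′
  ⟶-weaken {r′ = r′} refl m≤m′ (p , e) = p , ≤-trans e (+-monoˡ-≤ (weight r′) m≤m′)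

  -- The index `nothing` stands for the sentinel: only the empty run can follow it, so a sequence
  -- with an exhausted head is used up.
  data RunAfter : Maybe Str → Run → Set (a Level.⊔ ℓ) where
    []   : ∀ {p} → RunAfter p []
    cons : ∀ {p h} → p ⊑ s → h ≡ lcp p s → RunAfter (just s) r →
           RunAfter (just p) ((s , just h) ∷ r)

  data SortedRun : Run → Set (a Level.⊔ ℓ) where
    []   : SortedRun []
    cons : RunAfter (just s) r → SortedRun ((s , nothing) ∷ r)

  -- Matches

  Head : Set a
  Head = Maybe (Str × ℕ)

  key : Head → Maybe Str
  key = Maybe.map proj₁

  headRun : Head → Run
  headRun nothing        = []
  headRun (just (s , h)) = [ (s , just h) ]

  present : Head → ℕ
  present = Maybe.maybe′ (λ _ → 1) 0

  present≤1 : ∀ x → present x ≤ 1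
  present≤1 (just _) = ≤-refl
  present≤1 nothing  = z≤n

  data After : Maybe Str → Head → Set (a Level.⊔ ℓ) where
    none : ∀ {p} → After p nothing
    some : ∀ {p h} → p ⊑ s → h ≡ lcp p s → After (just p) (just (s , h))

  -- The winner comes back unchanged; the loser keeps its index and string, but its LCP value is
  -- rebased from the former reference string to the winner.
  data Ranked (x y : Contender d) : Contender d × Contender d → Set (a Level.⊔ ℓ) where
    first  : ∀ {z} → key z ≡ key (head y) → After (key (head x)) z →
             Ranked x y (x , contender (index y) z)
    second : ∀ {z} → key z ≡ key (head x) → After (key (head y)) z →
             Ranked x y (y , contender (index x) z)

  lcpCompare-ranked : ∀ {p} (x y : Contender d) → After p (head x) → After p (head y) →
                      Ranked x y (result (lcpCompare x y))
  lcpCompare-ranked x (contender j nothing) px py = first refl none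
  lcpCompare-ranked (contender i nothing) (contender _ (just _)) px py = second refl none
  lcpCompare-ranked {p = just p} (contender i (just (s , h))) (contender j (just (t , h′)))
    (some p⊑s eq) (some p⊑t eq′) with <-cmp h h′
  ... | tri< h<h′ _ _
    with t⊑s , eq″ ← larger-lcp⇒smaller p⊑s p⊑t (subst₂ _<_ eq eq′ h<h′)
    = second refl (some t⊑s (trans eq eq″))
  ... | tri> _ _ h′<h
    with s⊑t , eq″ ← larger-lcp⇒smaller p⊑t p⊑s (subst₂ _<_ eq′ eq h′<h)
    = first refl (some s⊑t (trans eq′ eq″))
  ... | tri≈ _ refl _
    with result (compareFrom h (drop h s) (drop h t)) | compareFrom-comparison h (drop h s) (drop h t)
  ... | _ | ≤-result s⊑t h″≡
    with lcp≡ , ⊑⁺ ← drop-common h p s t (≤-reflexive eq) (≤-reflexive eq′)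
    = first refl (some (⊑⁺ s⊑t) (trans h″≡ (sym lcp≡)))
  ... | _ | ≥-result t⊑s h″≡
    with lcp≡ , ⊑⁺ ← drop-common h p t s (≤-reflexive eq′) (≤-reflexive eq)
    = second refl (some (⊑⁺ t⊑s)
        (trans h″≡ (trans (cong (h +_) (lcp-comm (drop h s) (drop h t))) (sym lcp≡))))

  -- This is the normal form of the goal in `lcpCompare-pays` for equal LCP values: the winner keeps
  -- `h`, the loser rises from `h` to `h″`.
  raise-loser : ∀ h c h″ → c + h ≡ suc h″ → c + 0 + (h + (h + 0)) ≤ 1 + (h + (h″ + 0))
  raise-loser h c h″ eq = ≤-reflexive (trans (eq₁ h c) (trans (cong (h +_) eq) (eq₂ h h″)))
    where
    eq₁ : ∀ h c → c + 0 + (h + (h + 0)) ≡ h + (c + h)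
    eq₁ = solve-∀
    eq₂ : ∀ h h″ → h + suc h″ ≡ 1 + (h + (h″ + 0))
    eq₂ = solve-∀

  -- Equalities are paid by the rise of the loser's value, and the allowance covers the final
  -- mismatch test. A sentinel loses without any comparison and gets no allowance, so empty runs
  -- cost nothing in `build`.
  lcpCompare-pays : ∀ (x y : Contender d) →
    let m = lcpCompare x y; winner = proj₁ (result m); loser = proj₂ (result m) in
    headRun (head x) ++ headRun (head y)
      ⟶[ comparisons m , present (head loser) ]
    headRun (head winner) ++ headRun (head loser)
  lcpCompare-pays x (contender j nothing) = ⟶-refl
  lcpCompare-pays (contender i nothing) (contender _ (just _)) = ⟶-refl
  lcpCompare-pays (contender i (just (s , h))) (contender j (just (t , h′))) with <-cmp h h′
  ... | tri< _ _ _ = ⟶-weaken refl z≤n (↭⇒⟶ (++-comm [ _ ] [ _ ]))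
  ... | tri> _ _ _ = ⟶-weaken refl z≤n ⟶-refl
  ... | tri≈ _ refl _
    with result (compareFrom h (drop h s) (drop h t))
       | comparisons (compareFrom h (drop h s) (drop h t))
       | compareFrom-comparisons h (drop h s) (drop h t)
  ... | true  , h″ | c | eq = ↭-refl , raise-loser h c h″ eq
  ... | false , h″ | c | eq = ++-comm [ s ] [ t ] , raise-loser h c h″ eq

  -- Loser trees

  -- Puts the first subtree on side `b`, so that matches coming from the left and from the right
  -- share their proofs.
  graft : Bool → Contender (suc d) → LoserTree d → LoserTree d → LoserTree (suc d)
  graft false y l r = node y l r
  graft true  y l r = node y r l

  -- The string w, whose sequence has leaf i, has won all its matches in the tree,
  -- and every stored LCP value is relative to the winner of that match.
  data Tournament : ∀ {d} → Maybe Str → Vec Bool d → LoserTree d → Set (a Level.⊔ ℓ) where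
    leaf  : ∀ {w} → RunAfter w r → Tournament w [] (leaf r)
    left  : ∀ {w z i j} {l r : LoserTree d} → After w z →
            Tournament w i l → Tournament (key z) j r →
            Tournament w (false ∷ i) (node (contender (true ∷ j) z) l r)
    right : ∀ {w z i j} {l r : LoserTree d} → After w z →
            Tournament w i r → Tournament (key z) j l →
            Tournament w (true ∷ i) (node (contender (false ∷ j) z) l r)

  entries : LoserTree d → Run
  entries (leaf r)     = r
  entries (node z l r) = headRun (head z) ++ entries l ++ entries r

  -- `After nothing` admits only exhausted losers, and these pass `nothing` on to their own
  -- subtrees.
  exhausted-entries : ∀ {i} {T : LoserTree d} → Tournament nothing i T → entries T ≡ []
  exhausted-entries (leaf [])         = refl
  exhausted-entries (left none tl tr)
    rewrite exhausted-entries tl | exhausted-entries tr = refl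
  exhausted-entries (right none tr tl)
    rewrite exhausted-entries tl | exhausted-entries tr = refl

  -- A tournament depends on its winner's string only, so rebasing the loser's LCP value leaves the
  -- tournament in its subtree intact.
  play : ∀ b (x y : Contender d) {l r w z} →
         Ranked (below b x) (below (not b) y) (w , z) →
         Tournament (key (head x)) (index x) l → Tournament (key (head y)) (index y) r →
         Tournament (key (head w)) (index w) (graft b z l r)
  play false _ _ {r = r} (first  eq z) tx ty =
    left z tx (subst (λ u → Tournament u _ r) (sym eq) ty)
  play false _ _ {l = l} (second eq z) tx ty =
    right z ty (subst (λ u → Tournament u _ l) (sym eq) tx)
  play true  _ _ {r = r} (first  eq z) tx ty =
    right z tx (subst (λ u → Tournament u _ r) (sym eq) ty)
  play true  _ _ {l = l} (second eq z) tx ty =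
    left z ty (subst (λ u → Tournament u _ l) (sym eq) tx)

  winner-after : ∀ {p} {x y w z : Contender d} → Ranked x y (w , z) →
                 After p (head x) → After p (head y) → After p (head w)
  winner-after (first  _ _) px py = px
  winner-after (second _ _) px py = py

  -- Here `p` is the string output last, or the empty string before the first output.
  record Reached (p : Maybe Str) (x : Contender d) (T : LoserTree d) : Set (a Level.⊔ ℓ) where
    constructor reached
    field
      after      : After p (head x)
      tournament : Tournament (key (head x)) (index x) T

  open Reached

  contents : Contender d × LoserTree d → Run
  contents (x , T) = headRun (head x) ++ entries T

  advance-reached : ∀ {p r} → RunAfter p r →
                    Reached p (proj₁ (advance r)) (proj₂ (advance r))
  advance-reached []               = reached none (leaf [])
  advance-reached (cons p⊑s eq rs) = reached (some p⊑s eq) (leaf rs)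

  advance-contents : ∀ {p r} → RunAfter p r → contents (advance r) ≡ r
  advance-contents []            = refl
  advance-contents (cons _ _ _)  = refl

  match : ∀ b {p} (x y : Contender d) {l r} → Reached p x l → Reached p y r →
          let m = result (lcpCompare (below b x) (below (not b) y)) in
          Reached p (proj₁ m) (graft b (proj₂ m) l r)
  match b x y (reached px tx) (reached py ty) =
    reached (winner-after ranked px py) (play b x y ranked tx ty)
    where ranked = lcpCompare-ranked (below b x) (below (not b) y) px py

  graft-entries : ∀ b (z : Contender (suc d)) l r →
                  entries (graft b z l r) ↭ headRun (head z) ++ entries l ++ entries r
  graft-entries false z l r = ↭-refl
  graft-entries true  z l r = ++⁺ˡ (headRun (head z)) (++-comm (entries r) (entries l))

  match-pays : ∀ b (x y : Contender d) l r →
    let o = lcpCompare (below b x) (below (not b) y); w = proj₁ (result o); z = proj₂ (result o) in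
    contents (x , l) ++ contents (y , r)
      ⟶[ comparisons o , present (head z) ]
    contents (w , graft b z l r)
  match-pays b x y l r =
    ⟶-weaken (trans (+-identityʳ _) (+-identityʳ _))
             (≤-reflexive (trans (+-identityʳ _) (+-identityʳ _)))
      -- Bring the two heads together, let them play beside the untouched rest, then regroup the
      -- result as the new tree.
      (⟶-trans (↭⇒⟶ (interchange hx (entries l) hy (entries r)))
        (⟶-trans (⟶-++ (lcpCompare-pays (below b x) (below (not b) y)) ⟶-refl)
          (↭⇒⟶ (↭-trans (↭-reflexive (++-assoc hw hz _))
                         (++⁺ˡ hw (↭-sym (graft-entries b z l r)))))))
    where
    open import Algebra.Properties.CommutativeSemigroup
      (CommutativeMonoid.commutativeSemigroup ↭.++-commutativeMonoid) using (interchange)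
    w = proj₁ (result (lcpCompare (below b x) (below (not b) y)))
    z = proj₂ (result (lcpCompare (below b x) (below (not b) y)))
    hx = headRun (head x)
    hy = headRun (head y)
    hw = headRun (head w)
    hz = headRun (head z)

  -- Replaying a path

  -- The source is `entries T` without a winner, since that string has just been output. The
  -- allowance is one mismatch per match on the path.
  Replayed : Maybe Str → LoserTree d → Cost (Contender d × LoserTree d) → Set (a Level.⊔ ℓ)
  Replayed {d} p T m =
    Reached p (proj₁ (result m)) (proj₂ (result m)) ×
    entries T ⟶[ comparisons m , d ] contents (result m)

  replay-match : ∀ b {p} (x y : Contender d) l {l′ r} →
    Reached p x l′ → Reached p y r → ∀ {c} → entries l ⟶[ c , d ] contents (x , l′) →
    let m = lcpCompare (below b x) (below (not b) y); w = proj₁ (result m); z = proj₂ (result m) in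
    entries (graft b (below (not b) y) l r)
      ⟶[ c + comparisons m , suc d ]
    contents (w , graft b z l′ r)
  replay-match {d} b x y l {l′} {r} Rx Ry {c} l⟶ =
    ⟶-weaken (cong (_+ _) (+-identityʳ c))
             (≤-trans (+-mono-≤ (≤-reflexive (+-identityʳ d)) (present≤1 (head z)))
                      (≤-reflexive (+-comm d 1)))
      (⟶-trans (↭⇒⟶ (↭-trans (graft-entries b (below (not b) y) l r)
                              (shifts (headRun (head y)) (entries l))))
        (⟶-trans (⟶-++ l⟶ ⟶-refl) (match-pays b x y l′ r)))
    where z = proj₂ (result (lcpCompare (below b x) (below (not b) y)))

  -- The losers on the path were beaten by the string `p` just output, and the next string of its
  -- run also has its LCP value relative to `p`. So each match on the way up has `p` as common
  -- reference.
  replay-correct : ∀ {p i} {T : LoserTree d} → Tournament p i T → Replayed p T (replay i T)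
  replay-correct (leaf rs) = advance-reached rs , subst (_ ⟶[ 0 , 0 ]_) (sym (advance-contents rs)) ⟶-refl
  replay-correct (left {z = z} {i} {j} {l} {r} pz tl tr) with Rx , l⟶ ← replay-correct tl =
    match false x (contender j z) Rx (reached pz tr) ,
    ⟶-weaken (cong (comparisons (replay i l) +_) (sym (+-identityʳ _))) ≤-refl
      (replay-match false x (contender j z) l Rx (reached pz tr) l⟶)
    where x = proj₁ (result (replay i l))
  replay-correct (right {z = z} {i} {j} {l} {r} pz tr tl) with Rx , r⟶ ← replay-correct tr =
    match true x (contender j z) Rx (reached pz tl) ,
    ⟶-weaken (cong (comparisons (replay i r) +_) (sym (+-identityʳ _))) ≤-refl
      (replay-match true x (contender j z) r Rx (reached pz tl) r⟶)
    where x = proj₁ (result (replay i r))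

  -- Building the tree

  SortedRuns : Tree Run d → Set _
  SortedRuns t = All SortedRun (leaves t)

  -- The witness `b` is the number of non-exhausted losers; together with the winner they are as
  -- many as the nonempty runs.
  Built : Tree Run d → Cost (Contender d × LoserTree d) → Set _
  Built t m =
    Reached (just []) winner (proj₂ (result m)) ×
    ∃[ b ] concat (leaves t) ⟶[ comparisons m , b ] contents (result m) ×
           b + present (head winner) ≡ sum (map occupied (leaves t))
    where winner = proj₁ (result m)

  present-key : ∀ x y → key x ≡ key y → present x ≡ present y
  present-key nothing  nothing  _ = refl
  present-key (just _) (just _) _ = refl

  present-match : ∀ {x y w z : Contender d} → Ranked x y (w , z) →
                  present (head z) + present (head w) ≡ present (head x) + present (head y)
  present-match {x = contender _ hx} {contender _ hy} (first {z = z} eq _) =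
    trans (cong (_+ present hx) (present-key z hy eq)) (+-comm (present hy) (present hx))
  present-match {x = contender _ hx} {contender _ hy} (second {z = z} eq _) =
    cong (_+ present hy) (present-key z hx eq)

  build-correct : ∀ (t : Tree Run d) → SortedRuns t → Built t (build t)
  build-correct (leaf []) ([] ∷ []) = reached none (leaf []) , 0 , ⟶-refl , refl
  -- The entry `⊥` becomes 0, the LCP with the empty string, which is the common reference of all
  -- leaves.
  build-correct (leaf ((s , nothing) ∷ r)) (cons rs ∷ []) =
    reached (some ([]⊑ s) refl) (leaf rs) , 0 ,
    ≡-⟶ (++-identityʳ _) (↭-refl , ≤-refl) , refl
  build-correct (node l r) ss
    with Rx , b , l⟶ , b≡ ← build-correct l (All.++⁻ˡ (leaves l) ss)
    with Ry , b′ , r⟶ , b′≡ ← build-correct r (All.++⁻ʳ (leaves l) ss) =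
    match false x y Rx Ry , b + b′ + present (head z) ,
    ⟶-weaken costs ≤-refl
      (⟶-trans (≡-⟶ (sym (concat-++ (leaves l) (leaves r))) (⟶-++ l⟶ r⟶))
               (match-pays false x y (proj₂ (result (build l))) (proj₂ (result (build r))))) ,
    (begin
      b + b′ + present (head z) + present (head w)   ≡⟨ +-assoc (b + b′) _ _ ⟩
      b + b′ + (present (head z) + present (head w)) ≡⟨ cong (b + b′ +_) (present-match ranked) ⟩
      b + b′ + (present (head x) + present (head y)) ≡⟨ interchange b b′ _ _ ⟩
      b + present (head x) + (b′ + present (head y)) ≡⟨ cong₂ _+_ b≡ b′≡ ⟩
      sum (map occupied (leaves l)) + sum (map occupied (leaves r)) ≡⟨ sum-++ (map occupied (leaves l)) _ ⟨
      sum (map occupied (leaves l) ++ map occupied (leaves r)) ≡⟨ cong sum (map-++ occupied (leaves l) (leaves r)) ⟨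
      sum (map occupied (leaves l ++ leaves r)) ∎)
    where
    open ≡-Reasoning
    x = proj₁ (result (build l))
    y = proj₁ (result (build r))
    o = lcpCompare (below false x) (below true y)
    w = proj₁ (result o)
    z = proj₂ (result o)
    ranked = lcpCompare-ranked (below false x) (below true y) (after Rx) (after Ry)
    costs : comparisons (build l) + comparisons (build r) + comparisons o ≡
            comparisons (build l) + (comparisons (build r) + (comparisons o + 0))
    costs = eq (comparisons (build l)) (comparisons (build r)) (comparisons o)
      where
      eq : ∀ a b c → a + b + c ≡ a + (b + (c + 0))
      eq = solve-∀
    interchange : ∀ a b c d → a + b + (c + d) ≡ a + c + (b + d)
    interchange = solve-∀

  -- Output and the whole merge

  -- The winner's LCP value is relative to the previous output `p`, hence already the LCP array
  -- entry. Each output adds one replay with allowance `d`, and `n` is large enough not to cut the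
  -- output short.
  outputs-correct : ∀ n {p} (x : Contender d) T → Reached p x T → length (contents (x , T)) ≤ n →
    RunAfter p (result (outputs n x T)) ×
    contents (x , T) ⟶[ comparisons (outputs n x T) , n * d ] result (outputs n x T)
  outputs-correct zero (contender _ nothing) T (reached _ tT) _ =
    [] , ↭⇒⟶ (↭-reflexive (exhausted-entries tT))
  outputs-correct (suc n) (contender _ nothing) T (reached _ tT) _ =
    [] , ⟶-weaken refl z≤n (↭⇒⟶ (↭-reflexive (exhausted-entries tT)))
  outputs-correct {d} (suc n) (contender i (just (s , h))) T (reached (some p⊑s eq) tT) (s≤s ≤n)
    with Rx , T⟶ ← replay-correct tT
    with rs , ⟶r ← outputs-correct n (proj₁ (result (replay i T))) _ Rx
                     (subst (_≤ n) (⟶-length T⟶) ≤n) =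
    cons p⊑s eq rs ,
    ⟶-weaken (cong (comparisons (replay i T) +_) (sym (+-identityʳ _))) ≤-refl
      (⟶-++ {r = [ _ ]} {0} {0} ⟶-refl (⟶-trans T⟶ ⟶r))

  undefineFirst-sorted : ∀ {p} → RunAfter p r → SortedRun (undefineFirst r)
  undefineFirst-sorted []            = []
  undefineFirst-sorted (cons _ _ rs) = cons rs

  -- The value given up is an LCP with the empty string, which is 0.
  undefineFirst-⟶ : RunAfter (just []) r → r ⟶[ 0 , 0 ] undefineFirst r
  undefineFirst-⟶ []              = ⟶-refl
  undefineFirst-⟶ (cons _ refl _) = ↭-refl , ≤-refl

  occupied-⟶ : r ⟶[ c , m ] r′ → occupied r ≡ occupied r′
  occupied-⟶ {r} {r′ = r′} p = begin
    occupied r            ≡⟨ occupied-map proj₁ r ⟨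
    occupied (strings r)  ≡⟨ occupied-↭ (permutes p) ⟩
    occupied (strings r′) ≡⟨ occupied-map proj₁ r′ ⟩
    occupied r′           ∎
    where open ≡-Reasoning

  occupied≤present : ∀ {i} {T : LoserTree d} {x} → Tournament (key x) i T →
                     occupied (headRun x ++ entries T) ≤ present x
  occupied≤present {x = nothing} tT rewrite exhausted-entries tT = z≤n
  occupied≤present {x = just _}  tT = ≤-refl

  -- The two uses of `occupied` say that building causes one mismatch less than there are nonempty
  -- runs. The list `rs` enters through an equation because the caller knows the leaves as the image
  -- of a map.
  kWayMerge-correct : ∀ k n (t : Tree Run k) {rs} → leaves t ≡ rs →
    All SortedRun rs → length (concat rs) ≤ n →
    let m = kWayMerge k n t in
    SortedRun (result m) ×
    strings (result m) ↭ strings (concat rs) ×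
    comparisons m + weight (concat rs) + occupied (concat rs) ≤
      sum (map occupied rs) + n * k + weight (result m)
  kWayMerge-correct k n t refl ss ≤n
    with Rx , b , t⟶ , b≡ ← build-correct t ss
    with rs , ⟶r ← outputs-correct n (proj₁ (result (build t))) _ Rx
                     (subst (_≤ n) (⟶-length t⟶) ≤n)
    with merged ← ⟶-trans (⟶-trans t⟶ ⟶r) (undefineFirst-⟶ rs) =
    undefineFirst-sorted rs , ↭-sym (permutes merged) , (begin
      0 + (cb + (co + 0)) + w + o        ≤⟨ +-monoʳ-≤ (cb + (co + 0) + w) o≤p ⟩
      cb + (co + 0) + w + p              ≡⟨ eq₁ cb co w p ⟩
      cb + co + 0 + w + p                ≤⟨ +-monoˡ-≤ p (pays merged) ⟩
      b + n * k + 0 + w′ + p             ≡⟨ eq₂ b (n * k) w′ p ⟩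
      b + p + n * k + w′                 ≡⟨ cong (λ z → z + n * k + w′) b≡ ⟩
      sum (map occupied (leaves t)) + n * k + w′ ∎)
    where
    open ≤-Reasoning
    cb = comparisons (build t)
    x = proj₁ (result (build t))
    co = comparisons (outputs n x (proj₂ (result (build t))))
    w = weight (concat (leaves t))
    o = occupied (concat (leaves t))
    p = present (head x)
    w′ = weight (result (kWayMerge k n t))
    -- A tree below an exhausted winner is empty, so any remaining string forces the winner to be
    -- present.
    o≤p : o ≤ p
    o≤p = ≤-trans (≤-reflexive (occupied-⟶ t⟶)) (occupied≤present {x = head x} (tournament Rx))
    eq₁ : ∀ a b c d → a + (b + 0) + c + d ≡ a + b + 0 + c + d
    eq₁ = solve-∀
    eq₂ : ∀ a b c d → a + b + 0 + c + d ≡ a + d + b + c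
    eq₂ = solve-∀

  -- Splitting and sorting

  halve-↭ : ∀ S → proj₁ (result (halve S)) ++ proj₂ (result (halve S)) ↭ S
  halve-↭ []       = ↭-refl
  halve-↭ (s ∷ ss) =
    prep s (↭-trans (++-comm (proj₂ (result (halve ss))) _) (halve-↭ ss))

  halve-lengths : ∀ S → length (proj₁ (result (halve S))) ≡ ⌈ length S /2⌉ ×
                        length (proj₂ (result (halve S))) ≡ ⌊ length S /2⌋
  halve-lengths []       = refl , refl
  halve-lengths (s ∷ ss) with eq₁ , eq₂ ← halve-lengths ss = cong suc eq₂ , eq₁

  halve-≤ : ∀ S {n} → length S ≤ n + n → length (proj₁ (result (halve S))) ≤ n ×
                                          length (proj₂ (result (halve S))) ≤ n
  halve-≤ S {n} ≤n+n with eq₁ , eq₂ ← halve-lengths S =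
    ≤-trans (≤-reflexive eq₁) ⌈⌉≤n ,
    ≤-trans (≤-reflexive eq₂) (≤-trans (⌊n/2⌋≤⌈n/2⌉ (length S)) ⌈⌉≤n)
    where ⌈⌉≤n = ≤-trans (⌈n/2⌉-mono ≤n+n) (≤-reflexive (sym (n≡⌈n+n/2⌉ n)))

  halve-comparisons : ∀ S → comparisons (halve S) ≡ 0
  halve-comparisons []       = refl
  halve-comparisons (s ∷ ss) rewrite halve-comparisons ss = refl

  parts : ∀ k → List Str → List (List Str)
  parts k S = leaves (result (split k S))

  split-↭ : ∀ k S → concat (parts k S) ↭ S
  split-↭ zero    S = ↭-reflexive (++-identityʳ S)
  split-↭ (suc k) S = begin
    concat (parts k S₁ ++ parts k S₂)          ≡⟨ concat-++ (parts k S₁) (parts k S₂) ⟨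
    concat (parts k S₁) ++ concat (parts k S₂) ↭⟨ ↭.++⁺ (split-↭ k S₁) (split-↭ k S₂) ⟩
    S₁ ++ S₂                                   ↭⟨ halve-↭ S ⟩
    S                                          ∎
    where
    open PermutationReasoning
    S₁ = proj₁ (result (halve S))
    S₂ = proj₂ (result (halve S))

  -- Rounding up is harmless: a length of at most `m + m` leaves halves of at most `m`. With `n` a
  -- power of `2 ^ k`, the exponent drops by one per level of recursion.
  split-≤ : ∀ k S {n} → length S ≤ 2 ^ k * n → All (λ P → length P ≤ n) (parts k S)
  split-≤ zero    S {n} ≤n = ≤-trans ≤n (≤-reflexive (+-identityʳ n)) ∷ []
  split-≤ (suc k) S {n} ≤n =
    All.++⁺ (split-≤ k _ (proj₁ halves)) (split-≤ k _ (proj₂ halves))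
    where
    eq : ∀ m n → 2 * m * n ≡ m * n + m * n
    eq = solve-∀
    halves = halve-≤ S (≤-trans ≤n (≤-reflexive (eq (2 ^ k) n)))

  split-comparisons : ∀ k S → comparisons (split k S) ≡ 0
  split-comparisons zero    S = refl
  split-comparisons (suc k) S
    rewrite halve-comparisons S
          | split-comparisons k (proj₁ (result (halve S)))
          | split-comparisons k (proj₂ (result (halve S))) = refl

  -- The recursion of mergesort

  -- In use, `e` is the number of levels times `k` and bounds the replay mismatches per string. The
  -- rest, `length S` against `occupied S`, is for the mismatches in building trees.
  record Sorts (e : ℕ) (S : List Str) (m : Cost Run) : Set (a Level.⊔ ℓ) where
    constructor sorts
    field
      sorted   : SortedRun (result m)
      permuted : strings (result m) ↭ S
      bounded  : comparisons m + occupied S ≤ weight (result m) + length S * e + length S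

  open Sorts

  record SortsAll (e : ℕ) (Ss : List (List Str)) (f : List Str → Cost Run) : Set (a Level.⊔ ℓ) where
    constructor sortsAll
    runs = map (λ S → result (f S)) Ss
    field
      sorted   : All SortedRun runs
      permuted : strings (concat runs) ↭ concat Ss
      bounded  : sum (map (λ S → comparisons (f S)) Ss) + sum (map occupied runs) ≤
                 weight (concat runs) + length (concat Ss) * e + length (concat Ss)

  sorts-all : ∀ {e Ss f} → All (λ S → Sorts e S (f S)) Ss → SortsAll e Ss f
  sorts-all []                          = sortsAll [] ↭-refl z≤n
  sorts-all {e} {S ∷ Ss} {f} (sorts s p b ∷ all)
    with sortsAll ss ps bs ← sorts-all {f = f} all = sortsAll (s ∷ ss)
    (subst (_↭ S ++ concat Ss) (sym (map-++ proj₁ (result (f S)) _)) (↭.++⁺ p ps))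
    (begin
      c₁ + c₂ + (occupied (result (f S)) + os)      ≡⟨ cong (λ o → c₁ + c₂ + (o + os)) occupied≡ ⟩
      c₁ + c₂ + (occupied S + os)                   ≡⟨ interchange c₁ c₂ (occupied S) os ⟩
      c₁ + occupied S + (c₂ + os)                   ≤⟨ +-mono-≤ b bs ⟩
      w + n * e + n + (ws + ns * e + ns)           ≡⟨ eq w ws n ns e ⟩
      w + ws + (n + ns) * e + (n + ns)             ≡⟨ cong₂ (λ v l → v + l * e + l) (weight-++ (result (f S)) _) (length-++ S) ⟨
      weight (result (f S) ++ concat rs) + length (S ++ concat Ss) * e + length (S ++ concat Ss) ∎)
    where
    open ≤-Reasoning
    rs = map (λ S → result (f S)) Ss
    c₁ = comparisons (f S)
    c₂ = sum (map (λ S → comparisons (f S)) Ss)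
    os = sum (map occupied rs)
    w  = weight (result (f S))
    ws = weight (concat rs)
    n  = length S
    ns = length (concat Ss)
    occupied≡ : occupied (result (f S)) ≡ occupied S
    occupied≡ = trans (sym (occupied-map proj₁ (result (f S)))) (occupied-↭ p)
    interchange : ∀ a b c d → a + b + (c + d) ≡ a + c + (b + d)
    interchange = solve-∀
    eq : ∀ w ws n ns e → w + n * e + n + (ws + ns * e + ns) ≡ w + ws + (n + ns) * e + (n + ns)
    eq = solve-∀

  -- Induction on `d`, which governs the bound and will be the rounded logarithm; `d ≤ depth` keeps
  -- the recursion from reaching its cut-off.
  sortWithin-correct : ∀ k {d depth} S → length S ≤ (2 ^ k) ^ d → d ≤ depth →
                       Sorts (d * k) S (sortWithin k depth S)
  sortWithin-correct k []          _  _ = sorts [] ↭-refl z≤n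
  sortWithin-correct k {d} (s ∷ []) _ _ = sorts (cons []) ↭-refl (m≤n+m 1 (1 * (d * k)))
  sortWithin-correct k {zero} (_ ∷ _ ∷ _) (s≤s ()) _
  sortWithin-correct k {suc d} {suc depth} S@(_ ∷ _ ∷ _) ≤K^d (s≤s d≤depth)
    with sortsAll ss ps bs ← sorts-all {f = sortWithin k depth}
           (All.map (λ {P} ≤n → sortWithin-correct k P ≤n d≤depth) (split-≤ k S ≤K^d))
    with m , p , b ← kWayMerge-correct k (length S) (result (mapTree (sortWithin k depth) (result (split k S))))
           (mapTree-leaves (sortWithin k depth) (result (split k S))) ss
           (≤-reflexive (trans (sym (length-map proj₁ (concat (map (λ P → result (sortWithin k depth P)) (parts k S)))))
             (↭-length (↭-trans ps (split-↭ k S))))) =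
    sorts m (↭-trans p sorted↭)
      -- Adding `w + os` makes the telescoping visible: `w` is both the weight reached by the parts
      -- and that from which the merge starts, and `os` is both what the parts saved and what
      -- building may spend.
      (+-cancelʳ-≤ (w + os) _ _ (begin
        cs + (cm + ck) + 1 + (w + os)  ≡⟨ cong (λ z → z + (cm + ck) + 1 + (w + os)) (split-comparisons k S) ⟩
        cm + ck + 1 + (w + os)         ≡⟨ cong (λ z → cm + ck + z + (w + os)) occupied≡ ⟨
        cm + ck + o + (w + os)         ≡⟨ eq₁ cm ck o w os ⟩
        ck + w + o + (cm + os)         ≤⟨ +-mono-≤ b (≤-trans (≤-reflexive (cong (_+ os) cm≡)) bs) ⟩
        os + n * k + w′ + (w + nₚ * (d * k) + nₚ) ≡⟨ cong (λ z → os + n * k + w′ + (w + z * (d * k) + z)) (↭-length (split-↭ k S)) ⟩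
        os + n * k + w′ + (w + n * (d * k) + n)   ≡⟨ eq₂ os n k w′ w (d * k) ⟩
        w′ + n * (k + d * k) + n + (w + os) ∎))
    where
    open ≤-Reasoning
    runs = result (mapTree (sortWithin k depth) (result (split k S)))
    rs = map (λ P → result (sortWithin k depth P)) (parts k S)
    sorted↭ = ↭-trans ps (split-↭ k S)
    n  = length S
    nₚ = length (concat (parts k S))
    cs = comparisons (split k S)
    cm = comparisons (mapTree (sortWithin k depth) (result (split k S)))
    ck = comparisons (kWayMerge k (length S) runs)
    cm≡ = mapTree-comparisons (sortWithin k depth) (result (split k S))
    w  = weight (concat rs)
    w′ = weight (result (kWayMerge k n runs))
    o  = occupied (concat rs)
    os = sum (map occupied rs)
    occupied≡ : o ≡ 1
    occupied≡ = trans (sym (occupied-map proj₁ (concat rs))) (occupied-↭ sorted↭)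
    eq₁ : ∀ a b c d e → a + b + c + (d + e) ≡ b + d + c + (a + e)
    eq₁ = solve-∀
    eq₂ : ∀ o n k w′ w e → o + n * k + w′ + (w + n * e + n) ≡ w′ + n * (k + e) + n + (w + o)
    eq₂ = solve-∀

  -- Running time

  lcpCompare-time : ∀ (x y : Contender d) →
                    Bounded (time (lcpCompare x y)) (comparisons (lcpCompare x y)) 1
  lcpCompare-time x (contender j nothing) = bounded-step
  lcpCompare-time (contender i nothing) (contender _ (just _)) = bounded-step
  lcpCompare-time (contender i (just (s , h))) (contender j (just (t , h′))) with <-cmp h h′
  ... | tri< _ _ _ = bounded-step
  ... | tri> _ _ _ = bounded-step
  ... | tri≈ _ _ _ = bounded-+ bounded-step (bounded-+ compared bounded-return)
    where
    compared : Bounded (time (compareFrom h (drop h s) (drop h t)))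
                       (comparisons (compareFrom h (drop h s) (drop h t))) 0
    compared = bounded-by (≤-reflexive (trans (compareFrom-time h (drop h s) (drop h t))
                                              (sym (+-identityʳ _))))

  build-time : ∀ (t : Tree Run d) → Bounded (time (build t)) (comparisons (build t)) (buildSteps d)
  build-time (leaf r)   = bounded-step
  build-time (node l r) = bounded-+ bounded-step (bounded-+ (build-time l) (bounded-+ (build-time r)
    (bounded-+ (lcpCompare-time (below false x) (below true y)) bounded-return)))
    where
    x = proj₁ (result (build l))
    y = proj₁ (result (build r))

  -- One step at the leaf; on each level one for the call and one for the match.
  replay-time : ∀ i (T : LoserTree d) →
                Bounded (time (replay i T)) (comparisons (replay i T)) (1 + 2 * d)
  replay-time []          (leaf r)     = bounded-step
  replay-time {suc d} (false ∷ i) (node y l r) = bounded-weaken (≤-reflexive (eq d))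
    (bounded-+ bounded-step (bounded-+ (replay-time i l)
      (bounded-+ (lcpCompare-time (below false (proj₁ (result (replay i l)))) y) bounded-return)))
    where
    eq : ∀ d → 1 + (1 + 2 * d + (1 + 0)) ≡ 1 + 2 * (1 + d)
    eq = solve-∀
  replay-time {suc d} (true ∷ i)  (node y l r) = bounded-weaken (≤-reflexive (eq d))
    (bounded-+ bounded-step (bounded-+ (replay-time i r)
      (bounded-+ (lcpCompare-time (below true (proj₁ (result (replay i r)))) y) bounded-return)))
    where
    eq : ∀ d → 1 + (1 + 2 * d + (1 + 0)) ≡ 1 + 2 * (1 + d)
    eq = solve-∀

  outputs-time : ∀ n (x : Contender d) T →
    Bounded (time (outputs n x T)) (comparisons (outputs n x T)) (1 + n * (2 + 2 * d))
  outputs-time zero    _                     _ = bounded-step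
  outputs-time (suc n) (contender _ nothing) _ = bounded-weaken (s≤s z≤n) bounded-step
  outputs-time {d} (suc n) (contender i (just _)) T = bounded-weaken (≤-reflexive (eq n d))
    (bounded-+ bounded-step (bounded-+ (replay-time i T)
      (bounded-+ (outputs-time n _ (proj₂ (result (replay i T)))) bounded-return)))
    where
    eq : ∀ n d → 1 + (1 + 2 * d + (1 + n * (2 + 2 * d) + 0)) ≡ 1 + (1 + n) * (2 + 2 * d)
    eq = solve-∀

  kWayMerge-time : ∀ k n (t : Tree Run k) →
    Bounded (time (kWayMerge k n t)) (comparisons (kWayMerge k n t))
            (1 + (buildSteps k + (1 + n * (2 + 2 * k) + 0)))
  kWayMerge-time k n t = bounded-+ bounded-step (bounded-+ (build-time t)
    (bounded-+ (outputs-time n (proj₁ (result (build t))) (proj₂ (result (build t)))) bounded-return))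

  halve-time : ∀ S → time (halve S) ≡ suc (length S)
  halve-time []       = refl
  halve-time (s ∷ ss) = cong suc (trans (+-identityʳ _) (halve-time ss))

  split-time : ∀ k S → time (split k S) ≤ k * length S + splitSteps k
  split-time zero    S = ≤-refl
  split-time (suc k) S = begin
    1 + (time (halve S) + (time (split k S₁) + (time (split k S₂) + 0)))
      ≤⟨ s≤s (+-mono-≤ (≤-reflexive (halve-time S))
           (+-mono-≤ (split-time k S₁) (+-monoˡ-≤ 0 (split-time k S₂)))) ⟩
    1 + (suc n + (k * n₁ + splitSteps k + (k * n₂ + splitSteps k + 0)))
      ≡⟨ eq₁ n k n₁ n₂ (splitSteps k) ⟩
    n + k * (n₁ + n₂) + splitSteps (suc k)
      ≡⟨ cong (λ z → n + k * z + splitSteps (suc k)) n₁+n₂≡n ⟩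
    n + k * n + splitSteps (suc k) ∎
    where
    open ≤-Reasoning
    S₁ = proj₁ (result (halve S))
    S₂ = proj₂ (result (halve S))
    n  = length S
    n₁ = length S₁
    n₂ = length S₂
    n₁+n₂≡n : n₁ + n₂ ≡ n
    n₁+n₂≡n = trans (sym (length-++ S₁)) (↭-length (halve-↭ S))
    eq₁ : ∀ n k n₁ n₂ s → 1 + (1 + n + (k * n₁ + s + (k * n₂ + s + 0))) ≡
                          n + k * (n₁ + n₂) + (2 + (s + s))
    eq₁ = solve-∀

  sum-time : ∀ {f : List Str → Cost Run} {b e Ss} →
    All (λ S → Bounded (time (f S)) (comparisons (f S)) (1 + b * (length S * e))) Ss →
    Bounded (sum (map (λ S → time (f S)) Ss)) (sum (map (λ S → comparisons (f S)) Ss))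
            (length Ss + b * (length (concat Ss) * e))
  sum-time []                        = bounded-by z≤n
  sum-time {f} {b} {e} {S ∷ Ss} (t ∷ ts) = bounded-weaken (≤-reflexive eq) (bounded-+ t (sum-time {f} {b} {e} ts))
    where
    eq : 1 + b * (length S * e) + (length Ss + b * (length (concat Ss) * e)) ≡
         suc (length Ss) + b * (length (S ++ concat Ss) * e)
    eq = trans (eq₁ b e (length S) (length Ss) (length (concat Ss)))
               (cong (λ z → suc (length Ss) + b * (z * e)) (sym (length-++ S)))
      where
      eq₁ : ∀ b e l n m → 1 + b * (l * e) + (n + b * (m * e)) ≡ 1 + n + b * ((l + m) * e)
      eq₁ = solve-∀

  -- The summand 1 pays for empty and singleton calls, where the product may vanish. The summands of
  -- the `2 ^ k` parts go into the per-call constant of their parent.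
  sortWithin-time : ∀ k {d depth} S → length S ≤ (2 ^ k) ^ d → d ≤ depth →
    Bounded (time (sortWithin k depth S)) (comparisons (sortWithin k depth S))
            (1 + sortFactor k * (length S * d))
  sortWithin-time k []       _ _ = bounded-weaken (s≤s z≤n) bounded-step
  sortWithin-time k (_ ∷ []) _ _ = bounded-weaken (s≤s z≤n) bounded-step
  sortWithin-time k {zero} (_ ∷ _ ∷ _) (s≤s ()) _
  sortWithin-time k {suc d} {suc depth} S@(_ ∷ _ ∷ _) ≤K^d (s≤s d≤depth) =
    bounded-weaken (s≤s (begin
      k * n + σ + (2 * K + (length (parts k S) + φ * (nₚ * d)) + (1 + (β + (1 + n * (2 + 2 * k) + 0))))
        ≡⟨ cong₂ (λ l z → k * n + σ + (2 * K + (l + φ * (z * d)) + (1 + (β + (1 + n * (2 + 2 * k) + 0)))))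
             (leaves-length (result (split k S))) (↭-length (split-↭ k S)) ⟩
      k * n + σ + (2 * K + (K + φ * (n * d)) + (1 + (β + (1 + n * (2 + 2 * k) + 0))))
        ≡⟨ eq₁ k n σ K β (φ * (n * d)) ⟩
      (2 + 3 * k) * n + κ + φ * (n * d)
        -- The per-call cost `κ` is charged to the strings of the call, of which there are at least
        -- two.
        ≤⟨ +-monoˡ-≤ (φ * (n * d)) (+-monoʳ-≤ ((2 + 3 * k) * n) (m≤m*n κ n)) ⟩
      (2 + 3 * k) * n + κ * n + φ * (n * d)
        ≡⟨ eq₂ (2 + 3 * k) κ n d ⟩
      φ * (n * suc d) ∎))
    (bounded-+ bounded-step
      (bounded-+ (bounded-by {c = comparisons (split k S)} (≤-trans (split-time k S) (m≤n+m _ (comparisons (split k S)))))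
        (bounded-+ mapped (kWayMerge-time k n (result (mapTree sort (result (split k S))))))))
    where
    open ≤-Reasoning
    sort = sortWithin k depth
    n  = length S
    nₚ = length (concat (parts k S))
    K = 2 ^ k
    σ = splitSteps k
    β = buildSteps k
    φ = sortFactor k
    κ = σ + 3 * K + β + 2
    sum-mapped = sum-time {f = sort} {φ} {d}
      (All.map (λ {P} ≤n → sortWithin-time k P ≤n d≤depth) (split-≤ k S ≤K^d))
    mapped : Bounded (time (mapTree sort (result (split k S)))) (comparisons (mapTree sort (result (split k S))))
                     (2 * K + (length (parts k S) + φ * (nₚ * d)))
    mapped rewrite mapTree-comparisons sort (result (split k S)) = bounded-by
      (≤-trans (n≤1+n _) (≤-trans (≤-reflexive (mapTree-time sort (result (split k S))))
        (time≤ (bounded-+ (bounded-by {2 * K} {0} ≤-refl) sum-mapped))))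
    eq₁ : ∀ k n σ K β f → k * n + σ + (2 * K + (K + f) + (1 + (β + (1 + n * (2 + 2 * k) + 0)))) ≡
                          (2 + 3 * k) * n + (σ + 3 * K + β + 2) + f
    eq₁ = solve-∀
    eq₂ : ∀ a b n d → a * n + b * n + (a + b) * (n * d) ≡ (a + b) * (n * (1 + d))
    eq₂ = solve-∀

  -- The distinguishing prefix size

  take-lcp-prefix : ∀ i s t → i ≤ lcp s t → Prefix _≡_ (take i (terminated s)) (terminated t)
  take-lcp-prefix zero    s       t       _  = []
  take-lcp-prefix (suc i) (x ∷ s) (y ∷ t) i≤ with x A.≟ y
  ... | yes refl = refl ∷ take-lcp-prefix i s t (s≤s⁻¹ i≤)

  lcp≤length : ∀ s t → lcp s t ≤ length (terminated s)
  lcp≤length []      t       = z≤n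
  lcp≤length (x ∷ s) []      = z≤n
  lcp≤length (x ∷ s) (y ∷ t) with x A.≟ y
  ... | yes _ = s≤s (lcp≤length s t)
  ... | no  _ = z≤n

  -- A prefix of length at most `lcp s t` is shared with `t` and distinguishes nothing; the default
  -- of `least` is the full length, which is large enough as well.
  lcp≤distinguishing : ∀ {S s t} → t ∈ S → t ≢ s → lcp s t ≤ distinguishingPrefixLength S s
  lcp≤distinguishing {S} {s} {t} t∈S t≢s =
    least-elim (distinguishing? S s) (length (terminated s)) (lcp s t ≤_)
      (λ {i} distinguishing → ≰⇒≥ λ i≤lcp → All.lookup distinguishing t∈S t≢s (take-lcp-prefix i s t i≤lcp))
      (lcp≤length s t)

  -- The LCP of two neighbours is charged to the later one; uniqueness makes neighbours distinct.
  L≤distinguishing : ∀ {S} ss → All (_∈ S) ss → Unique ss →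
                     L (lcpArray ss) ≤ sum (map (distinguishingPrefixLength S) ss)
  L≤distinguishing []       _           _        = z≤n
  L≤distinguishing {S} (s ∷ ss) (s∈ ∷ ss∈) uniq = ≤-trans (from s ss s∈ ss∈ uniq) (m≤n+m _ _)
    where
    from : ∀ s ss → s ∈ S → All (_∈ S) ss → Unique (s ∷ ss) →
           L (zipWith (λ t u → just (lcp t u)) (s ∷ ss) ss) ≤ sum (map (distinguishingPrefixLength S) ss)
    from s []       _  _          _                       = z≤n
    from s (t ∷ ss) s∈ (t∈ ∷ ss∈) ((s≢t ∷ _) ∷ uniq) = +-mono-≤
      (≤-trans (≤-reflexive (lcp-comm s t)) (lcp≤distinguishing s∈ s≢t))
      (from t ss t∈ ss∈ uniq)

  L≤D : ∀ {S ss} → ss ↭ S → Unique S → L (lcpArray ss) ≤ D S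
  L≤D {S} {ss} p uniq = ≤-trans
    (L≤distinguishing ss (All.tabulate (↭.∈-resp-↭ p)) (↭ₛ.Unique-resp-↭ (setoid Str) (↭⇒↭ₛ (↭-sym p)) uniq))
    (≤-reflexive (sum-↭ (map⁺ (distinguishingPrefixLength S) p)))

  -- From the invariant to the theorem

  sorted-strings : SortedRun r → Sorted (strings r)
  sorted-strings []        = []
  sorted-strings (cons rs) = from rs
    where
    from : RunAfter (just s) r → Sorted (s ∷ strings r)
    from []              = [-]
    from (cons s⊑t _ rs) = s⊑t ∷ from rs

  sorted-lcpArray : SortedRun r → map proj₂ r ≡ lcpArray (strings r)
  sorted-lcpArray []        = refl
  sorted-lcpArray (cons rs) = cong (nothing ∷_) (from rs)
    where
    from : RunAfter (just s) r →
           map proj₂ r ≡ zipWith (λ t u → just (lcp t u)) (s ∷ strings r) (strings r)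
    from []               = refl
    from (cons _ refl rs) = cong (_ ∷_) (from rs)

mainTheorem5 : ∀ {a ℓ} (k : ℕ) .{{_ : NonZero k}} →
    let K = 2 ^ k in
    ∃[ c ] ∀ {A : Set a} {_≺_ : Rel A ℓ} (isSTO : IsStrictTotalOrder _≡_ _≺_) →
      let open LCPMergesort isSTO in
      (S : List Str) → Unique S →
      let n      = length S
          run    = mergesort k S
          sorted = map proj₁ (result run)
          H      = lcpArray sorted
      in
      Sorted sorted × sorted ↭ S × map proj₂ (result run) ≡ H ×
      (1 ≤ n → comparisons run < L H + n * ⌈log[ K ] n ⌉ * k + n + ⌈_/_⌉ (n ∸ 1) (K ∸ 1) {{2^k∸1-nonZero k}}) ×
      time run ≤ c * (1 ⊔ (D S + n * ⌈log₂ n ⌉))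
-- The factor of n log n is `k` from the comparisons plus `sortFactor k` from the steps. The 3
-- absorbs `D S + N` and two ones, from `n≤n*⌈log₂n⌉+1` and `sortWithin-time`.
mainTheorem5 {a} {ℓ} k = k + sortFactor k + 3 , correct
  where
  correct : ∀ {A : Set a} {_≺_ : Rel A ℓ} (isSTO : IsStrictTotalOrder _≡_ _≺_) →
    let open LCPMergesort isSTO in
    (S : List Str) → Unique S →
    let n      = length S
        run    = mergesort k S
        sorted = map proj₁ (result run)
        H      = lcpArray sorted
    in
    Sorted sorted × sorted ↭ S × map proj₂ (result run) ≡ H ×
    (1 ≤ n → comparisons run < L H + n * ⌈log[ 2 ^ k ] n ⌉ * k + n + ⌈_/_⌉ (n ∸ 1) (2 ^ k ∸ 1) {{2^k∸1-nonZero k}}) ×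
    time run ≤ (k + sortFactor k + 3) * (1 ⊔ (D S + n * ⌈log₂ n ⌉))
  correct isSTO S unique =
    sorted-strings sorted , permuted , H≡ , (λ 1≤n → begin
      suc C                              ≡⟨ +-comm 1 C ⟩
      -- For a nonempty set `occupied S` is the 1 that makes the inequality strict.
      C + 1                              ≡⟨ cong (C +_) (occupied≡1 S 1≤n) ⟨
      C + occupied S                     ≤⟨ bounded′ ⟩
      ΛH + n * l * k + n                 ≤⟨ m≤m+n _ _ ⟩
      ΛH + n * l * k + n + ⌈_/_⌉ (n ∸ 1) (2 ^ k ∸ 1) {{2^k∸1-nonZero k}} ∎) ,
    (begin
      time run                           ≤⟨ time≤ (sortWithin-time k S n≤K^l l≤n) ⟩
      C + (1 + φ * (n * l))              ≤⟨ +-monoˡ-≤ _ (≤-trans (m≤m+n C _) bounded′) ⟩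
      ΛH + n * l * k + n + (1 + φ * (n * l)) ≡⟨ eq₁ ΛH n l k φ ⟩
      ΛH + n + 1 + (k + φ) * (n * l)     ≤⟨ +-mono-≤ (+-monoˡ-≤ 1 (+-mono-≤ (L≤D permuted unique) (n≤n*⌈log₂n⌉+1 n)))
                                                    (*-monoʳ-≤ (k + φ) (*-monoʳ-≤ n l≤lg)) ⟩
      D S + (N + 1) + 1 + (k + φ) * N    ≡⟨ eq₂ (D S) N k φ ⟩
      (D S + N) + 1 + 1 + (k + φ) * N    ≤⟨ +-mono-≤ (+-mono-≤ (+-mono-≤ X≤M 1≤M) 1≤M)
                                                    (*-monoʳ-≤ (k + φ) (≤-trans (m≤n+m N (D S)) X≤M)) ⟩
      M + M + M + (k + φ) * M            ≡⟨ eq₃ M k φ ⟩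
      (k + φ + 3) * M                    ∎)
    where
    open LCPMergesort isSTO
    open Properties isSTO
    open ≤-Reasoning
    n   = length S
    run = mergesort k S
    C   = comparisons run
    l   = ⌈log[ 2 ^ k ] n ⌉
    φ   = sortFactor k
    N   = n * ⌈log₂ n ⌉
    M   = 1 ⊔ (D S + N)
    ΛH  = L (lcpArray (map proj₁ (result run)))
    n≤K^l : n ≤ (2 ^ k) ^ l
    n≤K^l = n≤b^⌈log[b]n⌉ (2≤2^k k) n
    l≤n : l ≤ n
    l≤n = least≤bound (λ j → n ≤? (2 ^ k) ^ j) n
    l≤lg : l ≤ ⌈log₂ n ⌉
    l≤lg = ⌈log[b]n⌉≤⌈log₂n⌉ (2≤2^k k) n
    open Sorts (sortWithin-correct k S n≤K^l l≤n)
    H≡ = sorted-lcpArray sorted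
    bounded′ : C + occupied S ≤ ΛH + n * l * k + n
    bounded′ = ≤-trans bounded
      (≤-reflexive (cong₂ (λ w z → w + z + n) (cong L H≡) (sym (*-assoc n l k))))
    1≤M : 1 ≤ M
    1≤M = m≤m⊔n 1 (D S + N)
    X≤M : D S + N ≤ M
    X≤M = m≤n⊔m 1 (D S + N)
    eq₁ : ∀ w n l k f → w + n * l * k + n + (1 + f * (n * l)) ≡ w + n + 1 + (k + f) * (n * l)
    eq₁ = solve-∀
    eq₂ : ∀ d n k f → d + (n + 1) + 1 + (k + f) * n ≡ d + n + 1 + 1 + (k + f) * n
    eq₂ = solve-∀
    eq₃ : ∀ m k f → m + m + m + (k + f) * m ≡ (k + f + 3) * m
    eq₃ = solve-∀
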